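{- For every finite graph $G$, $\operatorname{bx}(G) \leq 6\operatorname{ltw}(G) + 4$.
   Context: A box in $\mathbb{R}^d$ is a Cartesian product of $d$ intervals of $\mathbb{R}$; the boxicity $\operatorname{bx}(G)$ is the minimum $d$ such that $G$ is the intersection graph of boxes in $\mathbb{R}^d$ (boxes $B_v$, $v\in V(G)$, with $B_v\cap B_w\ne\emptyset$ iff $vw\in E(G)$ for distinct $v,w$). A tree decomposition of $G$ is a family $(B_x : x\in V(T))$ of nonempty subsets of $V(G)$ indexed by the nodes of a tree $T$ such that for each $v\in V(G)$ the set $\{x: v\in B_x\}$ induces a nonempty connected subtree of $T$, and each edge $vw$ has both ends in some $B_x$. A layering of $G$ is a partition $(V_1,\dots,V_n)$ of $V(G)$ such that for every edge $vw$ there is $i\in[n-1]$ with $v,w\in V_i\cup V_{i+1}$. The layered treewidth $\operatorname{ltw}(G)$ is the minimum integer $k$ such that there exist a tree decomposition $(B_x:x\in V(T))$ and a layering $(V_1,\dots,V_n)$ of $G$ with $|B_x\cap V_i|\le k$ for every node $x$ and every $i$. -}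

module Defs where

open import Data.Nat using (ℕ; zero; suc; _+_; _*_; _≤_)
open import Data.Fin using (Fin)
open import Data.Bool using (Bool; true; false; if_then_else_)
open import Data.List using (List; []; _∷_; length; lookup)
open import Data.List.Relation.Unary.AllPairs using (AllPairs)
open import Data.Product using (Σ; ∃; ∃-syntax; _×_; _,_)
open import Data.Sum using (_⊎_)
open import Data.Rational using (ℚ) renaming (_≤_ to _≤ℚ_)
open import Relation.Binary.PropositionalEquality using (_≡_; _≢_)
open import Relation.Nullary using (¬_)

record Graph : Set where
  field
    n   : ℕ
    adj : Fin n → Fin n → Bool
    sym : ∀ v w → adj v w ≡ adj w v
    irr : ∀ v → adj v v ≡ false

open Graph public

Edge : (G : Graph) → Fin (n G) → Fin (n G) → Set
Edge G v w = adj G v w ≡ true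

count : ∀ {m} → (Fin m → Bool) → ℕ
count {zero}  P = 0
count {suc m} P = (if P Fin.zero then 1 else 0) + count {m} (λ i → P (Fin.suc i))

data Walk (G : Graph) : Fin (n G) → Fin (n G) → List (Fin (n G)) → Set where
  here : ∀ v → Walk G v v (v ∷ [])
  step : ∀ {u v w vs} → Edge G u v → Walk G v w vs → Walk G u w (u ∷ vs)

AllIn : ∀ {A : Set} → (A → Bool) → List A → Set
AllIn S []       = Data.Unit.⊤ where import Data.Unit
AllIn S (x ∷ xs) = (S x ≡ true) × AllIn S xs

InducesConnected : (G : Graph) → (Fin (n G) → Bool) → Set
InducesConnected G S =
  (∃[ x ] S x ≡ true) ×
  (∀ x y → S x ≡ true → S y ≡ true → ∃[ vs ] (Walk G x y vs × AllIn S vs))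

Connected : Graph → Set
Connected G = ∀ x y → ∃[ vs ] Walk G x y vs

HasCycle : Graph → Set
HasCycle G = ∃[ x ] ∃[ y ] ∃[ vs ]
  (Walk G x y vs × AllPairs _≢_ vs × (3 ≤ length vs) × Edge G y x)

IsTree : Graph → Set
IsTree T = (1 ≤ n T) × Connected T × ¬ HasCycle T

record TreeDecomposition (G : Graph) : Set where
  field
    T       : Graph
    isTree  : IsTree T
    bag     : Fin (n T) → Fin (n G) → Bool
    nonempty : ∀ x → ∃[ v ] bag x v ≡ true
    subtree : ∀ v → InducesConnected T (λ x → bag x v)
    covers  : ∀ v w → Edge G v w → ∃[ x ] (bag x v ≡ true × bag x w ≡ true)

open TreeDecomposition public

-- Layerings: vertex v lies in layer V_(layer v); layers indexed by ℕ
-- (only finitely many are nonempty; empty layers are allowed)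

record Layering (G : Graph) : Set where
  field
    layer : Fin (n G) → ℕ
    edgeOK : ∀ v w → Edge G v w →
      ∃[ i ] ((layer v ≡ i ⊎ layer v ≡ suc i) × (layer w ≡ i ⊎ layer w ≡ suc i))

open Layering public

_≡ᵇ_ : ℕ → ℕ → Bool
zero  ≡ᵇ zero  = true
suc a ≡ᵇ suc b = a ≡ᵇ b
_     ≡ᵇ _     = false

_∧_ : Bool → Bool → Bool
true ∧ b = b
false ∧ b = false

LayeredTreewidth≤ : Graph → ℕ → Set
LayeredTreewidth≤ G k = Σ (TreeDecomposition G) λ D → Σ (Layering G) λ L →
  ∀ (x : Fin (n (T D))) (i : ℕ) →
    count (λ v → bag D x v ∧ (layer L v ≡ᵇ i)) ≤ k

record Box (d : ℕ) : Set where
  field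
    lo hi : Fin d → ℚ
    lo≤hi : ∀ j → lo j ≤ℚ hi j

open Box public

_∈Box_ : ∀ {d} → (Fin d → ℚ) → Box d → Set
p ∈Box B = ∀ j → (lo B j ≤ℚ p j) × (p j ≤ℚ hi B j)

BoxesIntersect : ∀ {d} → Box d → Box d → Set
BoxesIntersect {d} B C = ∃[ p ] (p ∈Box B × p ∈Box C)

-- G is the intersection graph of boxes in dimension d, i.e. bx(G) ≤ d
-- (boxicity is monotone in d, so this is exactly bx(G) ≤ d)
BoxRepresentable : Graph → ℕ → Set
BoxRepresentable G d = Σ (Fin (n G) → Box d) λ B →
  ∀ v w → v ≢ w → (Edge G v w → BoxesIntersect (B v) (B w))
                × (BoxesIntersect (B v) (B w) → Edge G v w)

{-# OPTIONS --safe #-}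
-- Order the nodes of the decomposition tree in depth-first preorder, and the vertices by the first
-- node whose bag contains them. Subtrees then do not cross: if a ≤ b ≤ c ≤ d, a and c share a bag,
-- and b and d share a bag, then a and b share a bag. Colouring greedily in this order gives k
-- colours such that vertices of equal colour and layer never share a bag; a class is a colour
-- together with a layer modulo 3. Call reach v the position of the last vertex sharing a bag with v.
-- The boxes use one interval [layer w, layer w + 1], one interval [pos w, reach w], and for each of
-- the 3k classes c an interval starting at the first of w and its neighbours in c, and ending at
-- pos w if w is in c and at reach w otherwise. Suppose v < w are not adjacent, and neither of
-- the first two intervals separates them. If the intervals of v and w for the class of v met, w
-- would have a neighbour u < v in that class; u and v would share a bag, and their layers, congruent
-- modulo 3 and both within 1 of that of w, would coincide. So 3k + 2 ≤ 6k + 4 dimensions suffice.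

module Submission where

open import Defs
open import Data.Bool using (Bool; true; false; not; if_then_else_)
open import Data.Bool.Properties using () renaming (_≟_ to _≟ᵇ_)
open import Data.Empty using (⊥-elim)
open import Data.Fin using (inject≤; Fin; zero; suc; toℕ; fromℕ<; combine; splitAt; _↑ˡ_; _↑ʳ_)
open import Data.Fin.Properties using (nonZeroIndex; _≟_; any?; ¬∀⟶∃¬; injective⇒≤; toℕ<n; toℕ-injective; combine-injective; fromℕ<-injective; splitAt-↑ˡ; splitAt-↑ʳ; ↑ʳ-injective)
import Data.Integer as ℤ
import Data.Integer.Properties as ℤ
open import Data.List using (List; []; _∷_; _++_; length; filter; allFin)
open import Data.List.Extrema using (argmin; argmax; argmin-all; argmax-all; f[argmin]≤f[xs]; f[xs]≤f[argmax])
open import Data.List.Membership.DecPropositional using (_∈?_)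
open import Data.List.Membership.Propositional using (_∈_)
open import Data.List.Membership.Propositional.Properties using (∈-filter⁺; ∈-allFin)
open import Data.List.Properties using (length-++)
open import Data.List.Relation.Unary.All as All using (All; []; _∷_)
open import Data.List.Relation.Unary.All.Properties using (all-filter; ¬Any⇒All¬)
open import Data.List.Relation.Unary.AllPairs using (AllPairs; []; _∷_)
import Data.List.Relation.Unary.AllPairs.Properties as AllPairs
open import Data.List.Relation.Unary.Any using (here; there)
open import Data.Nat using (ℕ; zero; suc; _+_; _*_; _≤_; _<_; _≤?_; _⊔_; _%_; _/_; z≤n; s≤s)
open import Data.Nat.Coprimality using (1-coprimeTo) renaming (sym to coprime-sym)
open import Data.Nat.DivMod using ([m+kn]%n≡m%n; m<n⇒m%n≡m; m≡m%n+[m/n]*n; m%n<n)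
open import Data.Nat.Properties using (≮⇒≥; +-monoˡ-<; m≤n+m; module ≤-Reasoning; ≤-refl; ≤-reflexive; ≤-trans; <⇒≤; ≰⇒>; ≤∧≢⇒<; <-≤-trans; ≤-pred; n≤1+n; m≤n⇒m≤1+n; m≤m⊔n; m≤n⊔m; ⊔-lub; ≤-totalOrder; *-monoˡ-≤; <-cmp; +-mono-≤; n≮n) renaming (_≟_ to _≟ⁿ_)
open import Data.Nat.Tactic.RingSolver using (solve-∀)
open import Data.Product using (Σ; ∃; ∃-syntax; _×_; _,_; proj₁; proj₂)
open import Data.Rational using (ℚ; mkℚ; *≤*) renaming (_≤_ to _≤ℚ_)
import Data.Rational.Properties as ℚ
open import Data.Sum using (_⊎_; inj₁; inj₂; [_,_]′)
open import Data.Unit using (⊤; tt)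
open import Function using (_∘_)
open import Relation.Binary using (Tri; tri<; tri≈; tri>)
open import Relation.Binary.PropositionalEquality using (_≡_; _≢_; refl; cong; cong₂; subst; subst₂; trans; ≢-sym) renaming (sym to ≡-sym)
open import Relation.Nullary using (¬_; ¬?; Dec; yes; no; does; _×-dec_; _⊎-dec_)
open import Relation.Unary using (Decidable)

-- Extremal elements and counting

module _ {m : ℕ} (f : Fin m → ℕ) {P : Fin m → Set} (P? : Decidable P) where

  abstract
    minimal : ∃ P → ∃[ x ] P x × (∀ {y} → P y → f x ≤ f y)
    minimal (x₀ , p₀) =
      argmin ≤-totalOrder f x₀ xs ,
      argmin-all ≤-totalOrder f {P = P} p₀ (all-filter P? (allFin m)) ,
      λ {y} py → All.lookup (f[argmin]≤f[xs] ≤-totalOrder {f = f} x₀ xs) (∈-filter⁺ P? (∈-allFin y) py)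
      where
      xs : List (Fin m)
      xs = filter P? (allFin m)

    maximal : ∃ P → ∃[ x ] P x × (∀ {y} → P y → f y ≤ f x)
    maximal (x₀ , p₀) =
      argmax ≤-totalOrder f x₀ xs ,
      argmax-all ≤-totalOrder f {P = P} p₀ (all-filter P? (allFin m)) ,
      λ {y} py → All.lookup (f[xs]≤f[argmax] ≤-totalOrder {f = f} x₀ xs) (∈-filter⁺ P? (∈-allFin y) py)
      where
      xs : List (Fin m)
      xs = filter P? (allFin m)

bounded : ∀ {m} (f : Fin m → ℕ) → ∃[ b ] (∀ x → f x < b)
bounded {zero}  f = 0 , λ ()
bounded {suc m} f with maximal f {λ _ → ⊤} (λ _ → yes tt) (zero , tt)
... | x , _ , max = suc (f x) , λ y → s≤s (max {y} tt)

private
  first : ∀ {b c} → b ≡ true → Fin ((if b then 1 else 0) + c)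
  first refl = zero

  first≢↑ʳ : ∀ {b c} (p : b ≡ true) (i : Fin c) → first p ≢ (if b then 1 else 0) ↑ʳ i
  first≢↑ʳ refl i ()

-- The index of u within P. Being injective, it lets `count P` bound any family of distinct elements
-- of P.
rank : ∀ {m} (P : Fin m → Bool) u → P u ≡ true → Fin (count P)
rank P zero    pu = first pu
rank P (suc u) pu = (if P zero then 1 else 0) ↑ʳ rank (P ∘ suc) u pu

rank-injective : ∀ {m} (P : Fin m → Bool) u v (pu : P u ≡ true) (pv : P v ≡ true) →
                 rank P u pu ≡ rank P v pv → u ≡ v
rank-injective P zero    zero    pu pv eq = refl
rank-injective P zero    (suc v) pu pv eq = ⊥-elim (first≢↑ʳ pu _ eq)
rank-injective P (suc u) zero    pu pv eq = ⊥-elim (first≢↑ʳ pv _ (≡-sym eq))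
rank-injective P (suc u) (suc v) pu pv eq =
  cong suc (rank-injective (P ∘ suc) u v pu pv (↑ʳ-injective (if P zero then 1 else 0) _ _ eq))

-- Pigeonhole: if every value were taken by an element of P other than v, one such element per value
-- together with v would give k + 1 distinct elements of P.
unused-value : ∀ {m k} (P : Fin m → Bool) → count P ≤ k → (f : Fin m → Fin k) →
               ∀ {v} → P v ≡ true → ∃[ c ] (∀ {u} → P u ≡ true → u ≢ v → f u ≢ c)
unused-value {m} {k} P |P|≤k f {v} pv with ¬∀⟶∃¬ k Used used? all-used
  where
  Used : Fin k → Set
  Used c = ∃[ u ] P u ≡ true × u ≢ v × f u ≡ c
  used? : Decidable Used
  used? c = any? λ u → (P u ≟ᵇ true) ×-dec ¬? (u ≟ v) ×-dec (f u ≟ c)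
  all-used : ¬ (∀ c → Used c)
  all-used used = n≮n k (≤-trans (injective⇒≤ {f = position} position-injective) |P|≤k)
    where
    element : Fin (suc k) → Fin m
    element zero    = v
    element (suc c) = proj₁ (used c)
    element∈P : ∀ i → P (element i) ≡ true
    element∈P zero    = pv
    element∈P (suc c) = proj₁ (proj₂ (used c))
    element-injective : ∀ i j → element i ≡ element j → i ≡ j
    element-injective zero    zero    eq = refl
    element-injective zero    (suc d) eq = ⊥-elim (proj₁ (proj₂ (proj₂ (used d))) (≡-sym eq))
    element-injective (suc c) zero    eq = ⊥-elim (proj₁ (proj₂ (proj₂ (used c))) eq)
    element-injective (suc c) (suc d) eq = cong suc
      (trans (≡-sym (proj₂ (proj₂ (proj₂ (used c))))) (trans (cong f eq) (proj₂ (proj₂ (proj₂ (used d))))))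
    position : Fin (suc k) → Fin (count P)
    position i = rank P (element i) (element∈P i)
    position-injective : ∀ {i j} → position i ≡ position j → i ≡ j
    position-injective {i} {j} eq = element-injective i j (rank-injective P _ _ _ _ eq)
... | c , unused = c , λ pu u≢v fu≡c → unused (_ , pu , u≢v , fu≡c)

-- Walks

allIn⇒All : ∀ {A : Set} (S : A → Bool) {xs} → AllIn S xs → All (λ x → S x ≡ true) xs
allIn⇒All S {[]}     _        = []
allIn⇒All S {x ∷ xs} (p , ps) = p ∷ allIn⇒All S ps

allIn-map : ∀ {A : Set} {S S′ : A → Bool} → (∀ {x} → S x ≡ true → S′ x ≡ true) →
            ∀ {xs} → AllIn S xs → AllIn S′ xs
allIn-map f {[]}     _        = tt
allIn-map f {x ∷ xs} (p , ps) = f p , allIn-map f ps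

module _ {H : Graph} where

  edge-sym : ∀ {u v} → Edge H u v → Edge H v u
  edge-sym {u} {v} e = trans (sym H v u) e

  walk-++ : ∀ {w x y z vs ws} → Walk H w x vs → Edge H x y → Walk H y z ws → Walk H w z (vs ++ ws)
  walk-++ (here _)   e w′ = step e w′
  walk-++ (step f w) e w′ = step f (walk-++ w e w′)

  walk-snoc : ∀ {S x y z vs} → Walk H x y vs → AllIn S vs → Edge H y z → S z ≡ true →
              ∃[ ws ] (Walk H x z ws × AllIn S ws)
  walk-snoc (here _)   (p , _)  e q = _ , step e (here _) , p , q , tt
  walk-snoc (step f w) (p , ps) e q with walk-snoc w ps e q
  ... | _ , w′ , ps′ = _ , step f w′ , p , ps′

  SimpleWalk : (Fin (n H) → Bool) → Fin (n H) → Fin (n H) → Set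
  SimpleWalk S x y = ∃[ vs ] (Walk H x y vs × AllIn S vs × AllPairs _≢_ vs)

  simple-suffix : ∀ {S u x y vs} → u ∈ vs → Walk H x y vs → AllIn S vs → AllPairs _≢_ vs →
                  SimpleWalk S u y
  simple-suffix (here refl) w@(here _)   ps ds = _ , w , ps , ds
  simple-suffix (here refl) w@(step _ _) ps ds = _ , w , ps , ds
  simple-suffix (there u∈)  (step _ w) (_ , ps) (_ ∷ ds) = simple-suffix u∈ w ps ds

  -- Loop erasure: when the start recurs in the simplified tail, only the suffix from that
  -- occurrence is kept.
  simplify : ∀ {S x y vs} → Walk H x y vs → AllIn S vs → SimpleWalk S x y
  simplify (here _) ps = _ , here _ , ps , [] ∷ []
  simplify {S} {x} (step e w) (p , ps) with simplify w ps
  ... | vs , w′ , ps′ , ds with _∈?_ _≟_ x vs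
  ...   | yes x∈ = simple-suffix x∈ w′ ps′ ds
  ...   | no  x∉ = _ , step e w′ , (p , ps′) , ¬Any⇒All¬ _ x∉ ∷ ds

  -- Cut the walk at its first vertex z in S: the part up to the preceding vertex y avoids S, as
  -- `re-entry` requires, and z inherits A because it lies on the walk.
  first-entry : ∀ {A S x u vs} → Walk H x u vs → AllIn A vs → S x ≡ false → S u ≡ true →
                ∃[ y ] ∃[ z ] (∃[ ws ] (Walk H x y ws × AllIn (not ∘ S) ws)) ×
                              Edge H y z × S z ≡ true × A z ≡ true
  first-entry (here _) _ x∉S x∈S with () ← trans (≡-sym x∉S) x∈S
  first-entry {S = S} (step {v = v} e w) (_ , ps) x∉S u∈S with S v in eq
  ... | true  = _ , v , (_ , here _ , cong not x∉S , tt) , e , eq , head-in w ps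
    where
    head-in : ∀ {A x u vs} → Walk H x u vs → AllIn A vs → A x ≡ true
    head-in (here _)   (p , _) = p
    head-in (step _ _) (p , _) = p
  ... | false with first-entry w ps eq u∈S
  ...   | y , z , (_ , w′ , qs) , rest = y , z , (_ , step e w′ , cong not x∉S , qs) , rest

  nontrivial-length : ∀ {x y vs} → Walk H x y vs → x ≢ y → 2 ≤ length vs
  nontrivial-length (here _)            x≢y = ⊥-elim (x≢y refl)
  nontrivial-length (step _ (here _))   x≢y = s≤s (s≤s z≤n)
  nontrivial-length (step _ (step _ _)) x≢y = s≤s (s≤s z≤n)

  nonempty-length : ∀ {x y vs} → Walk H x y vs → 1 ≤ length vs
  nonempty-length (here _)   = s≤s z≤n
  nonempty-length (step _ _) = s≤s z≤n

  -- Leaving the connected set S through the edge q l and re-entering it at z ≠ q closes a cycle.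
  re-entry : ∀ {S} → ¬ HasCycle H →
             (∀ {x y} → S x ≡ true → S y ≡ true → ∃[ vs ] (Walk H x y vs × AllIn S vs)) →
             ∀ {q l y z vs} → S q ≡ true → Edge H q l →
             Walk H l y vs → AllIn (not ∘ S) vs → Edge H y z → S z ≡ true → z ≡ q
  re-entry {S} acyclic conn {q} {z = z} q∈S ql w out yz z∈S with z ≟ q
  ... | yes z≡q = z≡q
  ... | no  z≢q
    with conn z∈S q∈S
  ... | _ , w′ , in′
    with simplify w out | simplify w′ in′
  ... | vs , w₁ , out₁ , ds₁ | ws , w₂ , in₂ , ds₂ =
    ⊥-elim (acyclic (_ , _ , vs ++ ws , walk-++ w₁ yz w₂ , AllPairs.++⁺ ds₁ ds₂ disjoint , long , ql))
    where
    disjoint : All (λ x → All (x ≢_) ws) vs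
    disjoint = All.map (λ x∉S → All.map (λ { y∈S refl → true≢not x∉S y∈S }) (allIn⇒All S in₂))
                       (allIn⇒All (not ∘ S) out₁)
      where
      true≢not : ∀ {b} → not b ≡ true → ¬ (b ≡ true)
      true≢not {true}  ()
      true≢not {false} _ ()
    long : 3 ≤ length (vs ++ ws)
    long = ≤-trans (+-mono-≤ (nonempty-length w₁) (nontrivial-length w₂ z≢q)) (≤-reflexive (≡-sym (length-++ vs)))

-- Depth-first numberings of the decomposition tree

-- Frees the number `suc t` for a new node by moving everything above t up by one, preserving the
-- order.
shift : ℕ → ℕ → ℕ
shift t m with m ≤? t
... | yes _ = m
... | no  _ = suc m

shift-cancel-≤ : ∀ t a b → shift t a ≤ shift t b → a ≤ b
shift-cancel-≤ t a b le with a ≤? t | b ≤? t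
... | yes _   | yes _   = le
... | yes a≤t | no  b≰t = ≤-trans a≤t (<⇒≤ (≰⇒> b≰t))
... | no  _   | yes _   = ≤-trans (n≤1+n a) le
... | no  _   | no  _   = ≤-pred le

shift≤⇒≤ : ∀ t a → shift t a ≤ suc t → a ≤ t
shift≤⇒≤ t a le with a ≤? t
... | yes a≤t = a≤t
... | no  _   = ≤-pred le

≤shift⇒< : ∀ t a → suc t ≤ shift t a → t < a
≤shift⇒< t a le with a ≤? t
... | yes a≤t = ⊥-elim (n≮n t (≤-trans le a≤t))
... | no  a≰t = ≰⇒> a≰t

module _ {G : Graph} (D : TreeDecomposition G) where

  private
    Node Vertex : Set
    Node   = Fin (n (T D))
    Vertex = Fin (n G)

    acyclic : ¬ HasCycle (T D)
    acyclic = proj₂ (proj₂ (isTree D))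

  infix 4 _∋_
  _∋_ : Node → Vertex → Set
  x ∋ v = bag D x v ≡ true

  -- A partial numbering, meaningful on `seen` only, that grows by one node at a time. Connectedness
  -- of `seen` is what `re-entry` asks for when a node is attached.
  record Numbering : Set where
    field
      seen      : Node → Bool
      num       : Node → ℕ
      connected : ∀ {x y} → seen x ≡ true → seen y ≡ true →
                  ∃[ vs ] (Walk (T D) x y vs × AllIn seen vs)
      -- In a preorder, x is an ancestor of z, hence of y, so it lies between y and the first node
      -- containing a.
      nested    : ∀ {a b s x y z} →
                  seen s ≡ true → seen x ≡ true → seen y ≡ true → seen z ≡ true →
                  num s ≤ num x → num x ≤ num y → num y ≤ num z →
                  s ∋ a → y ∋ a → x ∋ b → z ∋ b →
                  (∀ {u} → seen u ≡ true → u ∋ b → num x ≤ num u) → x ∋ a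

  open Numbering

  singleton : Node → Numbering
  singleton r = record
    { seen      = λ u → does (u ≟ r)
    ; num       = λ _ → 0
    ; connected = λ p q → conn p q
    ; nested    = λ {a} {_} {s} {x} s∈ x∈ _ _ _ _ _ s∋a _ _ _ _ →
        subst (_∋ a) (trans (only {s} s∈) (≡-sym (only {x} x∈))) s∋a
    }
    where
    only : ∀ {u} → does (u ≟ r) ≡ true → u ≡ r
    only {u} p with yes u≡r ← u ≟ r = u≡r
    conn : ∀ {x y} → does (x ≟ r) ≡ true → does (y ≟ r) ≡ true →
           ∃[ vs ] (Walk (T D) x y vs × AllIn (λ u → does (u ≟ r)) vs)
    conn {x} {y} p q with only {x} p | only {y} q
    ... | refl | refl = _ , here _ , p , tt

  -- Inserting the new node l right after its neighbour q keeps the numbering a preorder.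
  module Insert (O : Numbering) {q l : Node} (q∈ : seen O q ≡ true) (l∉ : seen O l ≡ false)
                (ql : Edge (T D) q l) where

    -- A walk from l to u through bags containing v first enters the old nodes at q, since any other
    -- point of entry would close a cycle.
    running-intersection : ∀ {u v} → l ∋ v → seen O u ≡ true → u ∋ v → q ∋ v
    running-intersection {u} {v} l∋v u∈ u∋v
      with proj₂ (subtree D v) l u l∋v u∋v
    ... | _ , w , ps
      with first-entry w ps l∉ u∈
    ... | y , z , (_ , w′ , out) , yz , z∈ , z∋v =
      subst (_∋ v) (re-entry acyclic (connected O) q∈ ql w′ out yz z∈) z∋v

    seen′ : Node → Bool
    seen′ u = if does (u ≟ l) then true else seen O u

    num′ : Node → ℕ
    num′ u = if does (u ≟ l) then suc (num O q) else shift (num O q) (num O u)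

    -- The retraction of the enlarged tree onto the old one. It is monotone for the numberings, so
    -- `nested′` can be pulled back to `nested`.
    parent : Node → Node
    parent u = if does (u ≟ l) then q else u

    data View (u : Node) : Set where
      new : u ≡ l → num′ u ≡ suc (num O q) → parent u ≡ q → View u
      old : seen O u ≡ true → num′ u ≡ shift (num O q) (num O u) → parent u ≡ u → View u

    view : ∀ {u} → seen′ u ≡ true → View u
    view {u} u∈ with u ≟ l in eq
    ... | yes u≡l = new u≡l (cong (λ d → if does d then suc (num O q) else shift (num O q) (num O u)) eq)
                            (cong (λ d → if does d then q else u) eq)
    ... | no  u≢l = old u∈ (cong (λ d → if does d then suc (num O q) else shift (num O q) (num O u)) eq)
                           (cong (λ d → if does d then q else u) eq)

    seen⇒seen′ : ∀ {u} → seen O u ≡ true → seen′ u ≡ true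
    seen⇒seen′ {u} u∈ with does (u ≟ l)
    ... | true  = refl
    ... | false = u∈

    l∈ : seen′ l ≡ true
    l∈ with l ≟ l
    ... | yes _   = refl
    ... | no  l≢l = ⊥-elim (l≢l refl)

    old-num : ∀ {u} → seen O u ≡ true → num′ u ≡ shift (num O q) (num O u)
    old-num {u} u∈ with u ≟ l
    ... | no _ = refl
    ... | yes refl with () ← trans (≡-sym l∉) u∈

    parent-seen : ∀ {u} → seen′ u ≡ true → seen O (parent u) ≡ true
    parent-seen u∈ with view u∈
    ... | new _ _ eq  = trans (cong (seen O) eq) q∈
    ... | old u∈′ _ eq = trans (cong (seen O) eq) u∈′

    parent-mono : ∀ {u v} → seen′ u ≡ true → seen′ v ≡ true → num′ u ≤ num′ v →
                  num O (parent u) ≤ num O (parent v)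
    parent-mono {u} {v} u∈ v∈ le with view u∈ | view v∈
    ... | new _ nu pu | new _ nv pv rewrite pu | pv = ≤-refl
    ... | new _ nu pu | old _ nv pv rewrite pu | pv | nu | nv = <⇒≤ (≤shift⇒< _ (num O v) le)
    ... | old _ nu pu | new _ nv pv rewrite pu | pv | nu | nv = shift≤⇒≤ _ (num O u) le
    ... | old _ nu pu | old _ nv pv rewrite pu | pv | nu | nv = shift-cancel-≤ _ (num O u) (num O v) le

    -- Sending l to q could lose a vertex found only in the bag of l; a second occurrence, at the
    -- old node w, rules this out.
    parent-∋ : ∀ {u w v} → seen′ u ≡ true → u ∋ v → seen O w ≡ true → w ∋ v → parent u ∋ v
    parent-∋ u∈ u∋v w∈ w∋v with view u∈
    ... | new refl _ eq = subst (_∋ _) (≡-sym eq) (running-intersection u∋v w∈ w∋v)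
    ... | old _    _ eq = subst (_∋ _) (≡-sym eq) u∋v

    -- No old node carries the number `suc (num O q)`, which `shift` skips.
    between-new : ∀ {u} → seen′ u ≡ true → num′ l ≤ num′ u → num′ u ≤ num′ l → u ≡ l
    between-new u∈ l≤u u≤l with view u∈ | view l∈
    ... | new u≡l _ _  | _ = u≡l
    ... | old _ nu _ | old l∈O _ _ with () ← trans (≡-sym l∉) l∈O
    between-new {u} u∈ l≤u u≤l | old _ nu _ | new _ nl _ rewrite nu | nl =
      ⊥-elim (n≮n _ (<-≤-trans (≤shift⇒< _ (num O u) l≤u) (shift≤⇒≤ _ (num O u) u≤l)))

    new-after-q : ¬ (num′ l ≤ num′ q)
    new-after-q le with view l∈
    ... | old l∈O _ _ with () ← trans (≡-sym l∉) l∈O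
    new-after-q le | new _ nl _ rewrite nl | old-num q∈ = n≮n _ (≤shift⇒< _ (num O q) le)

    connected′ : ∀ {x y} → seen′ x ≡ true → seen′ y ≡ true →
                 ∃[ vs ] (Walk (T D) x y vs × AllIn seen′ vs)
    connected′ x∈ y∈ with view x∈ | view y∈
    ... | new refl _ _ | new refl _ _ = _ , here _ , l∈ , tt
    ... | old x∈O _ _  | old y∈O _ _ with connected O x∈O y∈O
    ...   | _ , w , ps = _ , w , allIn-map seen⇒seen′ ps
    connected′ x∈ y∈ | new refl _ _ | old y∈O _ _ with connected O q∈ y∈O
    ...   | _ , w , ps = _ , step (edge-sym {T D} ql) w , l∈ , allIn-map seen⇒seen′ ps
    connected′ x∈ y∈ | old x∈O _ _ | new refl _ _ with connected O x∈O q∈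
    ...   | _ , w , ps = walk-snoc w (allIn-map seen⇒seen′ ps) ql l∈

    nested′ : ∀ {a b s x y z} →
              seen′ s ≡ true → seen′ x ≡ true → seen′ y ≡ true → seen′ z ≡ true →
              num′ s ≤ num′ x → num′ x ≤ num′ y → num′ y ≤ num′ z →
              s ∋ a → y ∋ a → x ∋ b → z ∋ b →
              (∀ {u} → seen′ u ≡ true → u ∋ b → num′ x ≤ num′ u) → x ∋ a
    nested′ {a} s∈ x∈ y∈ z∈ s≤x x≤y y≤z s∋a y∋a x∋b z∋b min with view x∈ | view z∈
    ... | new refl _ _ | new refl _ _ = subst (_∋ a) (between-new y∈ x≤y y≤z) y∋a
    -- By running intersection b also lies in the bag of q, which is numbered before l, against the
    -- minimality of x.
    ... | new refl _ _ | old z∈O _ _  =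
      ⊥-elim (new-after-q (min (seen⇒seen′ q∈) (running-intersection x∋b z∈O z∋b)))
    nested′ {a} {b} {s} {x} {y} {z} s∈ x∈ y∈ z∈ s≤x x≤y y≤z s∋a y∋a x∋b z∋b min | old x∈O nx px | _ =
      -- With x old, `nested` applies to the parents; x is the old occurrence of b that puts b in
      -- the bag of `parent z`.
      nested O (parent-seen s∈) x∈O (parent-seen y∈) (parent-seen z∈)
        (subst (λ t → num O (parent s) ≤ num O t) px (parent-mono s∈ x∈ s≤x))
        (subst (λ t → num O t ≤ num O (parent y)) px (parent-mono x∈ y∈ x≤y))
        (parent-mono y∈ z∈ y≤z)
        (proj₁ members) (proj₂ members) x∋b (parent-∋ z∈ z∋b x∈O x∋b)
        λ {u} u∈ u∋b → shift-cancel-≤ (num O q) (num O x) (num O u)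
          (subst (_≤ _) nx (subst (_ ≤_) (old-num u∈) (min (seen⇒seen′ u∈) u∋b)))
      where
      -- One of s and y is old and serves as the old occurrence of a for both: if both were l, x
      -- would be squeezed to l, although x is old.
      members : (parent s ∋ a) × (parent y ∋ a)
      members with view s∈ | view y∈
      ... | old s∈O _ _  | _             = parent-∋ s∈ s∋a s∈O s∋a , parent-∋ y∈ y∋a s∈O s∋a
      ... | new _ _ _    | old y∈O _ _   = parent-∋ s∈ s∋a y∈O y∋a , parent-∋ y∈ y∋a y∈O y∋a
      ... | new refl _ _ | new refl _ _
        with refl ← between-new x∈ s≤x x≤y
        with () ← trans (≡-sym l∉) x∈O

    insert : Numbering
    insert = record { seen = seen′ ; num = num′ ; connected = connected′ ; nested = nested′ }

  -- Each unseen node of the walk is inserted next to its predecessor on the walk, which has been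
  -- seen by then.
  extend-along : (O : Numbering) → ∀ {x y vs} → Walk (T D) x y vs → seen O x ≡ true →
                 ∃[ O′ ] (∀ {u} → seen O u ≡ true → seen O′ u ≡ true) × seen O′ y ≡ true
  extend-along O (here _) x∈ = O , (λ u∈ → u∈) , x∈
  extend-along O (step {v = v} e w) x∈ with seen O v in eq
  ... | true  = extend-along O w eq
  ... | false with extend-along (Insert.insert O x∈ eq e) w (Insert.l∈ O x∈ eq e)
  ...   | O′ , mono , y∈ = O′ , (λ u∈ → mono (Insert.seen⇒seen′ O x∈ eq e u∈)) , y∈

  numbering-of : ∀ r (xs : List Node) →
                 ∃[ O ] seen O r ≡ true × All (λ x → seen O x ≡ true) xs
  numbering-of r [] = singleton r , root∈ , []
    where
    root∈ : does (r ≟ r) ≡ true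
    root∈ with r ≟ r
    ... | yes _   = refl
    ... | no  r≢r = ⊥-elim (r≢r refl)
  numbering-of r (x ∷ xs) with numbering-of r xs
  ... | O , r∈ , xs∈ with extend-along O (proj₂ (proj₁ (proj₂ (isTree D)) r x)) r∈
  ...   | O′ , mono , x∈ = O′ , mono r∈ , x∈ ∷ All.map mono xs∈

  numbering : ∃[ O ] (∀ x → seen O x ≡ true)
  numbering with numbering-of (fromℕ< (proj₁ (isTree D))) (allFin _)
  ... | O , _ , all∈ = O , λ x → All.lookup all∈ (∈-allFin x)

  -- Orders on the vertices

  Share : Vertex → Vertex → Set
  Share u v = ∃[ x ] (x ∋ u × x ∋ v)

  share? : ∀ u v → Dec (Share u v)
  share? u v = any? λ x → (bag D x u ≟ᵇ true) ×-dec (bag D x v ≟ᵇ true)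

  share-sym : ∀ {u v} → Share u v → Share v u
  share-sym (x , x∋u , x∋v) = x , x∋v , x∋u

  share-refl : ∀ v → Share v v
  share-refl v with proj₁ (subtree D v)
  ... | x , x∋v = x , x∋v , x∋v

  -- When vertices sharing a bag are joined, `top-shared` makes the reverse of `pos` a perfect
  -- elimination order: v and its earlier neighbours lie in one bag. The colouring rests on this,
  -- the separation of boxes on `uncrossed`.
  record VertexOrder : Set where
    field
      pos           : Vertex → ℕ
      pos-injective : ∀ {u v} → pos u ≡ pos v → u ≡ v
      top           : Vertex → Node
      top-shared    : ∀ {u v} → Share u v → pos u ≤ pos v → top v ∋ u
      uncrossed     : ∀ {a b c d} → Share a c → Share b d →
                      pos a ≤ pos b → pos b ≤ pos c → pos c ≤ pos d → Share a b

  vertexOrder : VertexOrder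
  vertexOrder with numbering
  ... | O , all∈ = record
    { pos           = pos
    ; pos-injective = pos-injective
    ; top           = top
    ; top-shared    = top-shared
    -- Apply `nested` with `top a`, `top b`, `top c`, `top d` as s, x, y, z: a recurs at `top c` and
    -- b at `top d`.
    ; uncrossed     = λ {a} {b} ac bd a≤b b≤c c≤d →
        top b ,
        nested O (all∈ _) (all∈ _) (all∈ _) (all∈ _)
          (pos⇒num a≤b) (pos⇒num b≤c) (pos⇒num c≤d)
          (top∋ a) (top-shared ac (≤-trans a≤b b≤c))
          (top∋ b) (top-shared bd (≤-trans b≤c c≤d)) (λ _ → top-minimal b) ,
        top∋ b
    }
    where
    highest : ∀ v → ∃[ x ] x ∋ v × (∀ {y} → y ∋ v → num O x ≤ num O y)
    highest v = minimal (num O) (λ x → bag D x v ≟ᵇ true) (proj₁ (subtree D v))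

    top : Vertex → Node
    top v = proj₁ (highest v)

    top∋ : ∀ v → top v ∋ v
    top∋ v = proj₁ (proj₂ (highest v))

    top-minimal : ∀ v {y} → y ∋ v → num O (top v) ≤ num O y
    top-minimal v = proj₂ (proj₂ (highest v))

    -- Lexicographic: first the number of `top v`, then the index of v, which is below `n G` and so
    -- is the remainder modulo `n G`.
    pos : Vertex → ℕ
    pos v = toℕ v + num O (top v) * n G

    pos-injective : ∀ {u v} → pos u ≡ pos v → u ≡ v
    pos-injective {u} {v} eq = toℕ-injective (trans (≡-sym (residue u)) (trans (cong (_% n G) eq) (residue v)))
      where
      instance _ = nonZeroIndex u
      residue : ∀ w → pos w % n G ≡ toℕ w
      residue w = trans ([m+kn]%n≡m%n (toℕ w) (num O (top w)) (n G)) (m<n⇒m%n≡m (toℕ<n w))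

    pos⇒num : ∀ {u v} → pos u ≤ pos v → num O (top u) ≤ num O (top v)
    pos⇒num {u} {v} le = ≮⇒≥ λ v<u → n≮n (pos u) (begin-strict
      pos u                          ≤⟨ le ⟩
      pos v                          <⟨ +-monoˡ-< (num O (top v) * n G) (toℕ<n v) ⟩
      suc (num O (top v)) * n G      ≤⟨ *-monoˡ-≤ (n G) v<u ⟩
      num O (top u) * n G            ≤⟨ m≤n+m _ (toℕ u) ⟩
      pos u                          ∎)
      where open ≤-Reasoning

    top-shared : ∀ {u v} → Share u v → pos u ≤ pos v → top v ∋ u
    top-shared {u} {v} (x , x∋u , x∋v) le =
      -- The node x, whose bag contains both u and v, takes both places y and z of `nested`.
      nested O (all∈ _) (all∈ _) (all∈ _) (all∈ _)
        (pos⇒num le) (top-minimal v x∋v) ≤-refl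
        (top∋ u) x∋u (top∋ v) x∋v (λ _ → top-minimal v)

≡⇒≡ᵇ : ∀ {a b} → a ≡ b → (a ≡ᵇ b) ≡ true
≡⇒≡ᵇ {zero}  refl = refl
≡⇒≡ᵇ {suc a} refl = ≡⇒≡ᵇ {a} refl

∧-intro : ∀ {a b} → a ≡ true → b ≡ true → (a ∧ b) ≡ true
∧-intro refl refl = refl

-- Greedy colouring: the earlier vertices sharing a bag with v all lie in the bag of top v.
module Colouring {G : Graph} (D : TreeDecomposition G) (O : VertexOrder D) (L : Layering G) {k : ℕ}
                 (width : ∀ x i → count (λ v → bag D x v ∧ (layer L v ≡ᵇ i)) ≤ k) where

  open VertexOrder O

  private
    Vertex : Set
    Vertex = Fin (n G)

    peers : Vertex → Vertex → Bool
    peers v u = bag D (top v) u ∧ (layer L u ≡ᵇ layer L v)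

    peers-intro : ∀ {u v} → Share D u v → pos u ≤ pos v → layer L u ≡ layer L v → peers v u ≡ true
    peers-intro uv u≤v eq = ∧-intro (top-shared uv u≤v) (≡⇒≡ᵇ eq)

    v∈peers : ∀ v → peers v v ≡ true
    v∈peers v = peers-intro (share-refl D v) ≤-refl refl

  ProperOn : (Vertex → Set) → (Vertex → Fin k) → Set
  ProperOn A col = ∀ {u v} → A u → A v → u ≢ v → Share D u v → layer L u ≡ layer L v → col u ≢ col v

  colouring-below : ∀ m → Σ (Vertex → Fin k) (ProperOn (λ v → pos v < m))
  -- Nothing lies below position 0, so any colour will do. One exists because v is among its own
  -- peers, of which there are at most k.
  colouring-below zero = (λ v → inject≤ (rank (peers v) v (v∈peers v)) (width _ _)) , λ ()
  colouring-below (suc m) with colouring-below m | any? (λ v → pos v ≟ⁿ m)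
  ... | col , proper | no none = col , λ {u} {v} u< v< → proper (below u u<) (below v v<)
    where
    below : ∀ v → pos v < suc m → pos v < m
    below v v< = ≤∧≢⇒< (≤-pred v<) (λ eq → none (v , eq))
  ... | col , proper | yes (v , refl) with unused-value (peers v) (width _ _) col (v∈peers v)
  ...   | c , c-unused = col′ , proper′
    where
    col′ : Vertex → Fin k
    col′ u = if does (u ≟ v) then c else col u

    below : ∀ {u} → u ≢ v → pos u < suc (pos v) → pos u < pos v
    below u≢v u< = ≤∧≢⇒< (≤-pred u<) (u≢v ∘ pos-injective)

    fresh : ∀ {u} → pos u < suc (pos v) → u ≢ v → Share D u v → layer L u ≡ layer L v → col u ≢ c
    fresh u< u≢v uv eq = c-unused (peers-intro uv (≤-pred u<) eq) u≢v

    proper′ : ProperOn (λ u → pos u < suc (pos v)) col′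
    proper′ {u} {w} u< w< u≢w uw eq with u ≟ v | w ≟ v
    ... | yes refl | yes refl = ⊥-elim (u≢w refl)
    ... | yes refl | no  w≢v  = ≢-sym (fresh w< w≢v (share-sym D uw) (≡-sym eq))
    ... | no  u≢v  | yes refl = fresh u< u≢v uw eq
    ... | no  u≢v  | no  w≢v  = proper (below u≢v u<) (below w≢v w<) u≢w uw eq

  colouring : Σ (Vertex → Fin k) (ProperOn (λ _ → ⊤))
  colouring with bounded pos
  ... | b , pos<b with colouring-below b
  ...   | col , proper = col , λ {u} {v} _ _ → proper (pos<b u) (pos<b v)

-- Boxes with natural number corners

fromℕ : ℕ → ℚ
fromℕ m = mkℚ (ℤ.+ m) 0 (coprime-sym (1-coprimeTo m))

fromℕ-mono-≤ : ∀ {a b} → a ≤ b → fromℕ a ≤ℚ fromℕ b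
fromℕ-mono-≤ {a} {b} le =
  *≤* (subst₂ ℤ._≤_ (≡-sym (ℤ.*-identityʳ (ℤ.+ a))) (≡-sym (ℤ.*-identityʳ (ℤ.+ b))) (ℤ.+≤+ le))

fromℕ-cancel-≤ : ∀ {a b} → fromℕ a ≤ℚ fromℕ b → a ≤ b
fromℕ-cancel-≤ {a} {b} (*≤* le) =
  ℤ.drop‿+≤+ (subst₂ ℤ._≤_ (ℤ.*-identityʳ (ℤ.+ a)) (ℤ.*-identityʳ (ℤ.+ b)) le)

record Intervals (m : ℕ) : Set where
  field
    left right : Fin m → ℕ
    left≤right : ∀ v → left v ≤ right v

open Intervals

Meet : ∀ {m} → Intervals m → Fin m → Fin m → Set
Meet I v w = left I v ≤ right I w × left I w ≤ right I v

intervals⇒boxes : ∀ {G : Graph} {d} (I : Fin d → Intervals (n G)) →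
                  (∀ {v w} → v ≢ w → Edge G v w → ∀ j → Meet (I j) v w) →
                  (∀ {v w} → v ≢ w → (∀ j → Meet (I j) v w) → Edge G v w) →
                  BoxRepresentable G d
intervals⇒boxes I edge⇒meet meet⇒edge = box , λ v w v≢w →
  (λ e → corner v w , corner∈ v w (edge⇒meet v≢w e)) ,
  (λ { (p , p∈v , p∈w) → meet⇒edge v≢w λ j →
    fromℕ-cancel-≤ (ℚ.≤-trans (proj₁ (p∈v j)) (proj₂ (p∈w j))) ,
    fromℕ-cancel-≤ (ℚ.≤-trans (proj₁ (p∈w j)) (proj₂ (p∈v j))) })
  where
  box = λ v → record
    { lo    = λ j → fromℕ (left (I j) v)
    ; hi    = λ j → fromℕ (right (I j) v)
    ; lo≤hi = λ j → fromℕ-mono-≤ (left≤right (I j) v)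
    }
  -- The larger of the two left ends is a common point of two intervals that meet.
  corner = λ v w j → fromℕ (left (I j) v ⊔ left (I j) w)
  corner∈ : ∀ v w → (∀ j → Meet (I j) v w) → corner v w ∈Box box v × corner v w ∈Box box w
  corner∈ v w meet =
    (λ j → fromℕ-mono-≤ (m≤m⊔n _ _) , fromℕ-mono-≤ (⊔-lub (left≤right (I j) v) (proj₂ (meet j)))) ,
    (λ j → fromℕ-mono-≤ (m≤n⊔m _ _) , fromℕ-mono-≤ (⊔-lub (proj₁ (meet j)) (left≤right (I j) w)))

-- Every box gets the degenerate interval [0, 0] in each new coordinate, where all boxes meet.
boxRepresentable-+ : ∀ {G : Graph} {d} d′ → BoxRepresentable G d → BoxRepresentable G (d + d′)
boxRepresentable-+ {G} {d} d′ (B , rep) = box , λ v w v≢w →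
  (λ e → extend v w (proj₁ (rep v w v≢w) e)) ,
  (λ { (p , p∈v , p∈w) → proj₂ (rep v w v≢w) ((λ j → p (j ↑ˡ d′)) , restrict p∈v , restrict p∈w) })
  where
  pad : (Fin d → ℚ) → Fin (d + d′) → ℚ
  pad f j = [ f , (λ _ → fromℕ 0) ]′ (splitAt d j)
  pad-≤ : ∀ {f g} → (∀ j → f j ≤ℚ g j) → ∀ j → pad f j ≤ℚ pad g j
  pad-≤ f≤g j with splitAt d j
  ... | inj₁ i = f≤g i
  ... | inj₂ _ = ℚ.≤-refl
  box : Fin (n G) → Box (d + d′)
  box v = record { lo = pad (lo (B v)) ; hi = pad (hi (B v)) ; lo≤hi = pad-≤ (lo≤hi (B v)) }
  extend : ∀ v w → BoxesIntersect (B v) (B w) → BoxesIntersect (box v) (box w)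
  extend v w (p , p∈v , p∈w) =
    pad p ,
    (λ j → pad-≤ (proj₁ ∘ p∈v) j , pad-≤ (proj₂ ∘ p∈v) j) ,
    (λ j → pad-≤ (proj₁ ∘ p∈w) j , pad-≤ (proj₂ ∘ p∈w) j)
  pad-↑ˡ : ∀ f j → pad f (j ↑ˡ d′) ≡ f j
  pad-↑ˡ f j = cong [ f , (λ _ → fromℕ 0) ]′ (splitAt-↑ˡ d j d′)
  restrict : ∀ {v p} → p ∈Box box v → (λ j → p (j ↑ˡ d′)) ∈Box B v
  restrict {v} {p} p∈ j =
    subst (_≤ℚ p (j ↑ˡ d′)) (pad-↑ˡ (lo (B v)) j) (proj₁ (p∈ (j ↑ˡ d′))) ,
    subst (p (j ↑ˡ d′) ≤ℚ_) (pad-↑ˡ (hi (B v)) j) (proj₂ (p∈ (j ↑ˡ d′)))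

-- Layers modulo 3

private
  apart : ∀ a b → a % 3 ≡ b % 3 → a / 3 < b / 3 → 3 + a ≤ b
  apart a b eq lt = begin
    3 + a                   ≡⟨ cong (3 +_) (m≡m%n+[m/n]*n a 3) ⟩
    3 + (a % 3 + a / 3 * 3) ≡⟨ rearrange (a % 3) (a / 3 * 3) ⟩
    a % 3 + suc (a / 3) * 3 ≤⟨ +-mono-≤ (≤-reflexive eq) (*-monoˡ-≤ 3 lt) ⟩
    b % 3 + b / 3 * 3       ≡⟨ m≡m%n+[m/n]*n b 3 ⟨
    b                       ∎
    where
    open ≤-Reasoning
    rearrange : ∀ r t → 3 + (r + t) ≡ r + (3 + t)
    rearrange = solve-∀

-- Distinct numbers congruent modulo 3 differ by at least 3.
near-congruent : ∀ {a b} → a % 3 ≡ b % 3 → a ≤ 2 + b → b ≤ 2 + a → a ≡ b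
near-congruent {a} {b} eq a≤ b≤ with <-cmp (a / 3) (b / 3)
... | tri≈ _ eq′ _ = trans (m≡m%n+[m/n]*n a 3)
        (trans (cong₂ (λ r t → r + t * 3) eq eq′) (≡-sym (m≡m%n+[m/n]*n b 3)))
... | tri< lt _ _ = ⊥-elim (n≮n (2 + a) (≤-trans (apart a b eq lt) b≤))
... | tri> _ _ gt = ⊥-elim (n≮n (2 + b) (≤-trans (apart b a (≡-sym eq) gt) a≤))

-- Boxicity and layered treewidth

module _ {G : Graph} {k : ℕ} (D : TreeDecomposition G) (O : VertexOrder D) (L : Layering G)
         (col : Fin (n G) → Fin k)
         (proper : ∀ {u v} → u ≢ v → Share D u v → layer L u ≡ layer L v → col u ≢ col v) where

  open VertexOrder O

  private
    Vertex : Set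
    Vertex = Fin (n G)

    class : Vertex → Fin (3 * k)
    class v = combine (fromℕ< (m%n<n (layer L v) 3)) (col v)

    -- Equal classes and layers at most 2 apart give equal layer and colour, which `proper` forbids
    -- for distinct vertices sharing a bag.
    class-conflict : ∀ {u v} → class u ≡ class v → Share D u v →
                     layer L u ≤ 2 + layer L v → layer L v ≤ 2 + layer L u → u ≡ v
    class-conflict {u} {v} eq uv u≤ v≤ with u ≟ v | combine-injective _ (col u) _ (col v) eq
    ... | yes u≡v | _ = u≡v
    ... | no  u≢v | eq% , eq-col =
      ⊥-elim (proper u≢v uv (near-congruent (fromℕ<-injective _ _ _ _ eq%) u≤ v≤) eq-col)

    edge-share : ∀ {v w} → Edge G v w → Share D v w
    edge-share {v} {w} = covers D v w

    edge-layer : ∀ {v w} → Edge G v w → layer L v ≤ suc (layer L w)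
    edge-layer {v} {w} e with edgeOK L v w e
    ... | i , v≡ , w≡ = ≤-trans (upper v≡) (s≤s (lower w≡))
      where
      upper : layer L v ≡ i ⊎ layer L v ≡ suc i → layer L v ≤ suc i
      upper (inj₁ eq) = m≤n⇒m≤1+n (≤-reflexive eq)
      upper (inj₂ eq) = ≤-reflexive eq
      lower : layer L w ≡ i ⊎ layer L w ≡ suc i → i ≤ layer L w
      lower (inj₁ eq) = ≤-reflexive (≡-sym eq)
      lower (inj₂ eq) = ≤-trans (n≤1+n i) (≤-reflexive (≡-sym eq))

    furthest : ∀ v → ∃[ d ] Share D v d × (∀ {u} → Share D v u → pos u ≤ pos d)
    furthest v = maximal pos (share? D v) (v , share-refl D v)

    reach : Vertex → ℕ
    reach v = pos (proj₁ (furthest v))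

    share⇒≤reach : ∀ {v u} → Share D v u → pos u ≤ reach v
    share⇒≤reach {v} = proj₂ (proj₂ (furthest v))

    earliest : ∀ c w → ∃[ u ] (u ≡ w ⊎ class u ≡ c × Edge G u w) ×
                              (∀ {x} → x ≡ w ⊎ class x ≡ c × Edge G x w → pos u ≤ pos x)
    earliest c w = minimal pos (λ u → (u ≟ w) ⊎-dec ((class u ≟ c) ×-dec (adj G u w ≟ᵇ true))) (w , inj₁ refl)

    byLayer bySpan : Intervals (n G)
    byLayer = record { left = layer L ; right = suc ∘ layer L ; left≤right = λ v → n≤1+n _ }
    bySpan  = record { left = pos ; right = reach ; left≤right = λ v → share⇒≤reach (share-refl D v) }

    -- A member of c stops at its own position, so a later vertex meets it only by having an early
    -- enough neighbour in c. Other vertices extend to `reach`, at least as far as their last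
    -- neighbour.
    classEnd : Fin (3 * k) → Vertex → ℕ
    classEnd c v = if does (class v ≟ c) then pos v else reach v

    byClass : Fin (3 * k) → Intervals (n G)
    byClass c = record
      { left       = λ v → pos (proj₁ (earliest c v))
      ; right      = classEnd c
      ; left≤right = λ v → ≤-trans (proj₂ (proj₂ (earliest c v)) (inj₁ refl)) (pos≤end v)
      }
      where
      pos≤end : ∀ v → pos v ≤ classEnd c v
      pos≤end v with does (class v ≟ c)
      ... | true  = ≤-refl
      ... | false = share⇒≤reach (share-refl D v)

    classEnd-member : ∀ v → classEnd (class v) v ≡ pos v
    classEnd-member v with class v ≟ class v
    ... | yes _ = refl
    ... | no  ≢ = ⊥-elim (≢ refl)

    -- If w is in c, it competes for the left end of v, which is thus at most `pos w`; otherwise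
    -- already `pos v` is at most `reach w`.
    byClass-edge : ∀ c {v w} → Edge G v w → left (byClass c) v ≤ right (byClass c) w
    byClass-edge c {v} {w} e with class w ≟ c
    ... | yes w∈c = proj₂ (proj₂ (earliest c v)) (inj₂ (w∈c , edge-sym {G} e))
    ... | no  _   = ≤-trans (proj₂ (proj₂ (earliest c v)) (inj₁ refl))
                            (share⇒≤reach (share-sym D (edge-share e)))

    separated : ∀ {v w} → pos v < pos w → ¬ Edge G v w →
                Meet byLayer v w → Meet bySpan v w → ¬ Meet (byClass (class v)) v w
    separated {v} {w} v<w ¬vw (v≤w+1 , w≤v+1) (_ , w≤reach) (_ , left≤)
      with earliest (class v) w
    ... | u , inj₁ refl , _ = n≮n _ (≤-trans v<w (subst (pos w ≤_) (classEnd-member v) left≤))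
    ... | u , inj₂ (u∈c , uw) , _ = ¬vw (subst (λ x → Edge G x w) u≡v uw)
      where
      u≤v : pos u ≤ pos v
      u≤v = subst (pos u ≤_) (classEnd-member v) left≤
      uv : Share D u v
      -- Let d be the last vertex sharing a bag with v. In the order u, v, w, d the pairs u, w and
      -- v, d share bags.
      uv = uncrossed (edge-share uw) (proj₁ (proj₂ (furthest v))) u≤v (<⇒≤ v<w) w≤reach
      u≡v : u ≡ v
      -- The layers of u and v are both within 1 of that of w, hence within 2 of each other.
      u≡v = class-conflict u∈c uv
        (≤-trans (edge-layer uw) (s≤s w≤v+1))
        (≤-trans v≤w+1 (s≤s (edge-layer (edge-sym {G} uw))))

    byLayerOrSpan : Fin 2 → Intervals (n G)
    byLayerOrSpan zero    = byLayer
    byLayerOrSpan (suc _) = bySpan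

    intervals : Fin (3 * k + 2) → Intervals (n G)
    intervals j = [ byClass , byLayerOrSpan ]′ (splitAt (3 * k) j)

    -- One inequality of `Meet`; the other is this one for the reversed edge.
    intervals-edge : ∀ {v w} → Edge G v w → ∀ j → left (intervals j) v ≤ right (intervals j) w
    intervals-edge e j with splitAt (3 * k) j
    ... | inj₁ c       = byClass-edge c e
    ... | inj₂ zero    = edge-layer e
    ... | inj₂ (suc _) = share⇒≤reach (share-sym D (edge-share e))

    intervals-separate : ∀ {v w} → pos v < pos w → (∀ j → Meet (intervals j) v w) → Edge G v w
    intervals-separate {v} {w} v<w meet with adj G v w ≟ᵇ true
    ... | yes e  = e
    ... | no  ¬e = ⊥-elim (separated v<w ¬e (at₂ zero) (at₂ (suc zero)) (at₁ (class v)))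
      where
      at₁ : ∀ c → Meet (byClass c) v w
      at₁ c = subst (λ s → Meet ([ byClass , byLayerOrSpan ]′ s) v w) (splitAt-↑ˡ (3 * k) c 2) (meet (c ↑ˡ 2))
      at₂ : ∀ i → Meet (byLayerOrSpan i) v w
      at₂ i = subst (λ s → Meet ([ byClass , byLayerOrSpan ]′ s) v w) (splitAt-↑ʳ (3 * k) 2 i) (meet (3 * k ↑ʳ i))

  boxicity≤3k+2 : BoxRepresentable G (3 * k + 2)
  boxicity≤3k+2 = intervals⇒boxes {G} intervals
    (λ _ e j → intervals-edge e j , intervals-edge (edge-sym {G} e) j)
    λ {v} {w} v≢w meet → adjacent v≢w meet (<-cmp (pos v) (pos w))
    where
    adjacent : ∀ {v w} → v ≢ w → (∀ j → Meet (intervals j) v w) →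
               Tri (pos v < pos w) (pos v ≡ pos w) (pos w < pos v) → Edge G v w
    adjacent v≢w meet (tri< v<w _ _) = intervals-separate v<w meet
    adjacent v≢w meet (tri≈ _ eq _)  = ⊥-elim (v≢w (pos-injective eq))
    adjacent v≢w meet (tri> _ _ w<v) =
      edge-sym {G} (intervals-separate w<v λ j → proj₂ (meet j) , proj₁ (meet j))

boxicity≤3ltw+2 : (G : Graph) (k : ℕ) → LayeredTreewidth≤ G k → BoxRepresentable G (3 * k + 2)
boxicity≤3ltw+2 G k (D , L , width) = boxicity≤3k+2 D (vertexOrder D) L (proj₁ colouring) (proj₂ colouring tt tt)
  where open Colouring D (vertexOrder D) L width

theorem5p2 : (G : Graph) (k : ℕ) → LayeredTreewidth≤ G k → BoxRepresentable G (6 * k + 4)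
theorem5p2 G k ltw =
  -- The bound 6k + 4 is twice 3k + 2, so 3k + 2 idle coordinates are added.
  subst (BoxRepresentable G) (double k) (boxRepresentable-+ {G} (3 * k + 2) (boxicity≤3ltw+2 G k ltw))
  where
  double : ∀ k → (3 * k + 2) + (3 * k + 2) ≡ 6 * k + 4
  double = solve-∀
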